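{- For $k \ge 2$ and $n$ even, if $F_1, F_2, \ldots, F_k$ are $1$-factors on a common set of $n$ vertices, then \[ \gamma_{\rm sd}(F_1,F_2,\ldots,F_k) \le \begin{cases} \left( \dfrac{k-1}{k} \right) n & \text{if } k \text{ is even}, \\[2mm] \left( \dfrac{k}{k+1} \right) n & \text{if } k \text{ is odd}, \end{cases} \] and these bounds are sharp; that is, for every $k \ge 2$ there exist an even $n \geq 2$ and $1$-factors $F_1,\ldots,F_k$ on a common set of $n$ vertices for which equality holds.
   Context: All graphs are finite and simple. A $1$-factor on $n$ vertices is a $1$-regular graph on the $n$ vertices, i.e. a disjoint union of $n/2$ copies of $K_2$. Given graphs $F_1,\ldots,F_k$ (not necessarily edge-disjoint, and not necessarily distinct) with common vertex set $V$, a set $S \subseteq V$ is a simultaneous dominating set if for every $i$, $1 \le i \le k$, every vertex not in $S$ is adjacent in $F_i$ to some vertex of $S$. The simultaneous domination number $\gamma_{\rm sd}(F_1,\ldots,F_k)$ is the minimum cardinality of a simultaneous dominating set. -}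

module Defs where

open import Data.Bool.Base using (if_then_else_)
open import Data.Fin.Base using (Fin)
open import Data.Fin.Properties using (all?; any?)
open import Data.Fin.Subset using (Subset; inside; outside; ⊤; _∈_; _∉_; ∣_∣)
open import Data.Fin.Subset.Properties using (_∈?_; ∈⊤)
open import Data.Integer.Base using (+_)
open import Data.List.Base using (List; []; _∷_; _++_; map; filter)
open import Data.List.Extrema using (argmin; argmin-all; f[argmin]≤f[xs])
open import Data.List.Membership.Propositional using () renaming (_∈_ to _∈ˡ_)
open import Data.List.Membership.Propositional.Properties
  using (∈-map⁺; ∈-++⁺ˡ; ∈-++⁺ʳ; ∈-filter⁺)
open import Data.List.Relation.Unary.All using (lookup)
open import Data.List.Relation.Unary.All.Properties using (all-filter)
open import Data.List.Relation.Unary.Any using (here)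
open import Data.Nat.Base
  using (ℕ; zero; suc; _∸_; _≤_; NonTrivial; nonTrivial⇒nonZero)
open import Data.Nat.Divisibility using (_∣?_)
open import Data.Nat.Properties using (≤-totalOrder)
open import Data.Product.Base using (_×_; _,_; ∃-syntax)
open import Data.Rational.Base using (ℚ; _/_; _*_)
open import Data.Vec.Base using ([]; _∷_; tabulate)
open import Data.Vec.Functional using (Vector)
open import Level using (0ℓ)
open import Relation.Binary.Core using (Rel)
open import Relation.Binary.Definitions using (Decidable; Symmetric)
open import Relation.Binary.PropositionalEquality using (_≡_; refl)
open import Relation.Nullary.Decidable
  using (does; ¬?; _×-dec_; _→-dec_)
open import Relation.Nullary.Negation using (¬_; contradiction)
import Relation.Unary as U

-- A finite simple graph with vertex set Fin n.
record Graph (n : ℕ) : Set₁ where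
  field
    Adj    : Rel (Fin n) 0ℓ
    adj?   : Decidable Adj
    sym    : Symmetric Adj
    irrefl : ∀ v → ¬ Adj v v

open Graph public using (Adj; adj?)

private
  variable
    k n : ℕ

neighbourhood : Graph n → Fin n → Subset n
neighbourhood G v = tabulate (λ u → does (adj? G v u))

degree : Graph n → Fin n → ℕ
degree G v = ∣ neighbourhood G v ∣

IsRegular : ℕ → Graph n → Set
IsRegular r G = ∀ v → degree G v ≡ r

IsOneFactor : Graph n → Set
IsOneFactor = IsRegular 1

-- F is a family of k graphs on the same vertices; repetitions are allowed.
IsSimultaneousDominating : Vector (Graph n) k → Subset n → Set
IsSimultaneousDominating F S =
  ∀ i v → v ∉ S → ∃[ u ] (u ∈ S × Adj (F i) v u)

isSimultaneousDominating? :
  (F : Vector (Graph n) k) → U.Decidable (IsSimultaneousDominating F)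
isSimultaneousDominating? F S =
  all? λ i → all? λ v →
    ¬? (v ∈? S) →-dec any? λ u → (u ∈? S) ×-dec adj? (F i) v u

subsets : ∀ n → List (Subset n)
subsets zero    = [] ∷ []
subsets (suc n) = map (inside ∷_) (subsets n) ++ map (outside ∷_) (subsets n)

∈-subsets : (S : Subset n) → S ∈ˡ subsets n
∈-subsets []            = here refl
∈-subsets (inside ∷ S)  = ∈-++⁺ˡ (∈-map⁺ (inside ∷_) (∈-subsets S))
∈-subsets {suc n} (outside ∷ S) =
  ∈-++⁺ʳ (map (inside ∷_) (subsets n)) (∈-map⁺ (outside ∷_) (∈-subsets S))

simultaneousDominatingSets : Vector (Graph n) k → List (Subset n)
simultaneousDominatingSets F = filter (isSimultaneousDominating? F) (subsets _)

-- The default value ⊤ passed to argmin is itself simultaneous dominating,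
-- so it does not affect the minimum.
minimumSet : Vector (Graph n) k → Subset n
minimumSet F = argmin ≤-totalOrder ∣_∣ ⊤ (simultaneousDominatingSets F)

γsd : Vector (Graph n) k → ℕ
γsd F = ∣ minimumSet F ∣

γsd-attained : (F : Vector (Graph n) k) →
  ∃[ S ] (IsSimultaneousDominating F S × ∣ S ∣ ≡ γsd F)
γsd-attained F = minimumSet F , dominating , refl
  where
  dominating : IsSimultaneousDominating F (minimumSet F)
  dominating = argmin-all ≤-totalOrder ∣_∣ {P = IsSimultaneousDominating F}
    (λ i v v∉⊤ → contradiction ∈⊤ v∉⊤)
    (all-filter (isSimultaneousDominating? F) (subsets _))

γsd-minimal : (F : Vector (Graph n) k) (S : Subset n) →
  IsSimultaneousDominating F S → γsd F ≤ ∣ S ∣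
γsd-minimal F S dom =
  lookup (f[argmin]≤f[xs] ≤-totalOrder {f = ∣_∣} ⊤ (simultaneousDominatingSets F))
    (∈-filter⁺ (isSimultaneousDominating? F) (∈-subsets S) dom)

bound : (k n : ℕ) .{{_ : NonTrivial k}} → ℚ
bound k n =
  if does (2 ∣? k)
  then (+ (k ∸ 1) / k) * (+ n / 1)
  else (+ k / suc k) * (+ n / 1)
  where instance _ = nonTrivial⇒nonZero k

{-# OPTIONS --safe #-}

-- A set is simultaneous dominating iff its complement is independent in
-- G = F₁ ∪ … ∪ Fₖ, so γsd = n − α(G).  For odd k, α(G) ≥ n / (k + 1) because G
-- has maximum degree at most k.  For even k, α(G) ≥ n / k follows, without
-- Brooks' theorem, from a greedy argument and the parity of sets closed under a
-- 1-factor.  Both bounds are attained by the 1-factorization of a complete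
-- graph, on k vertices (one factor repeated) or on k + 1 vertices.
module Submission where

open import Defs
open import Data.Bool.Base using (if_then_else_)
open import Data.Fin.Base using (Fin; zero; suc; toℕ; fromℕ<; punchIn; punchOut)
open import Data.Fin.Properties
  using (any?; _≟_; punchIn-punchOut; toℕ-injective; toℕ<n; toℕ-fromℕ<; suc-injective)
open import Data.Fin.Subset
  using (Subset; inside; outside; ⊥; ⊤; ⁅_⁆; _∈_; _∉_; _⊆_; _⊂_; _⊃_; _∪_; _-_; ∁; ∣_∣; Nonempty)
open import Data.Fin.Subset.Induction using (Acc; acc; ⊂-wellFounded; ⊃-wellFounded)
open import Data.Fin.Subset.Properties
import Data.Integer.Base as ℤ
import Data.Integer.Properties as ℤ
open import Data.Nat.Base
  using (ℕ; zero; suc; _+_; _*_; _∸_; _<_; _≥_; z≤n; s≤s; _%_; NonZero; NonTrivial; nonTrivial⇒n>1)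
open import Data.Nat.Divisibility
  using (_∣_; _∣?_; ∣m∣n⇒∣m+n; ∣m+n∣m⇒∣n; ∣1⇒≡1; ∣m⇒∣m*n; ∣-refl; _∣0; divides; m%n≡0⇒n∣m)
open import Data.Nat.DivMod
  using (_mod_; m≡m%n+[m/n]*n; m%n<n; m%n%n≡m%n; m<n⇒m%n≡m; [m+kn]%n≡m%n; %-distribˡ-+; %-distribˡ-*)
import Data.Nat.Base as ℕ
import Data.Nat.Properties as ℕ
open import Data.Nat.Tactic.RingSolver using (solve-∀)
open import Data.Product.Base using (_×_; _,_; proj₁; proj₂; Σ-syntax; ∃-syntax)
open import Data.Rational.Base as ℚ using (ℚ; _/_; _≤_)
import Data.Rational.Properties as ℚ
import Data.Rational.Unnormalised.Base as ℚᵘ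
import Data.Rational.Unnormalised.Properties as ℚᵘ
open import Data.Sum.Base using (inj₁; inj₂; [_,_]′)
open import Data.Vec.Base using ([]; _∷_; here; there)
open import Data.Vec.Functional using (Vector) renaming (_∷_ to _◂_)
open import Data.Vec.Properties using (lookup∘tabulate; []=⇒lookup; lookup⇒[]=)
open import Function.Base using (_∘_)
open import Relation.Binary.PropositionalEquality
open import Relation.Nullary.Decidable
  using (Dec; yes; no; does; ¬?; _×-dec_; dec-true; dec-false; decidable-stable)
open import Relation.Nullary.Negation using (¬_; contradiction)

private
  variable
    k n : ℕ

-- Cardinalities of finite subsets.

∣p∪q∣≤∣p∣+∣q∣ : (p q : Subset n) → ∣ p ∪ q ∣ ℕ.≤ ∣ p ∣ + ∣ q ∣
∣p∪q∣≤∣p∣+∣q∣ []            []            = z≤n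
∣p∪q∣≤∣p∣+∣q∣ (outside ∷ p) (outside ∷ q) = ∣p∪q∣≤∣p∣+∣q∣ p q
∣p∪q∣≤∣p∣+∣q∣ (inside  ∷ p) (outside ∷ q) = s≤s (∣p∪q∣≤∣p∣+∣q∣ p q)
∣p∪q∣≤∣p∣+∣q∣ (outside ∷ p) (inside  ∷ q) rewrite ℕ.+-suc ∣ p ∣ ∣ q ∣ = s≤s (∣p∪q∣≤∣p∣+∣q∣ p q)
∣p∪q∣≤∣p∣+∣q∣ (inside  ∷ p) (inside  ∷ q) =
  s≤s (ℕ.≤-trans (∣p∪q∣≤∣p∣+∣q∣ p q) (ℕ.+-monoʳ-≤ ∣ p ∣ (ℕ.n≤1+n _)))

∣Empty∣≡0 : {p : Subset n} → ¬ Nonempty p → ∣ p ∣ ≡ 0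
∣Empty∣≡0 {n} empty = trans (cong ∣_∣ (Empty-unique empty)) (∣⊥∣≡0 n)

x∈p⇒∣p∣≡1+∣p-x∣ : {x : Fin n} {p : Subset n} → x ∈ p → ∣ p ∣ ≡ suc ∣ p - x ∣
x∈p⇒∣p∣≡1+∣p-x∣ {p = inside  ∷ p} here        = cong (suc ∘ ∣_∣) (sym (p─⊥≡p p))
x∈p⇒∣p∣≡1+∣p-x∣ {p = inside  ∷ p} (there x∈p) = cong suc (x∈p⇒∣p∣≡1+∣p-x∣ x∈p)
x∈p⇒∣p∣≡1+∣p-x∣ {p = outside ∷ p} (there x∈p) = x∈p⇒∣p∣≡1+∣p-x∣ x∈p

x∉p-x : (p : Subset n) (x : Fin n) → x ∉ p - x
x∉p-x (_ ∷ p) (suc x) (there x∈p-x) = x∉p-x p x x∈p-x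

x∈p-y⇒x≢y : {p : Subset n} {x y : Fin n} → x ∈ p - y → x ≢ y
x∈p-y⇒x≢y {p = p} {x} x∈p-y refl = x∉p-x p x x∈p-y

⊂-∪ : {p q : Subset n} {x : Fin n} → x ∉ p → x ∈ q → p ⊂ p ∪ q
⊂-∪ {p = p} {q} {x} x∉p x∈q = p⊆p∪q q , x , q⊆p∪q p q x∈q , x∉p

∣p∣≤1 : (p : Subset n) → (∀ {x y} → x ∈ p → y ∈ p → x ≡ y) → ∣ p ∣ ℕ.≤ 1
∣p∣≤1 p unique with nonempty? p
... | yes (x , x∈p) = subst (∣ p ∣ ℕ.≤_) (∣⁅x⁆∣≡1 x)
  (p⊆q⇒∣p∣≤∣q∣ λ y∈p → subst (_∈ ⁅ x ⁆) (unique x∈p y∈p) (x∈⁅x⁆ x))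
... | no empty = subst (ℕ._≤ 1) (sym (∣Empty∣≡0 empty)) z≤n

∣p∣≡1⇒∃! : (p : Subset n) → ∣ p ∣ ≡ 1 → ∃[ x ] (x ∈ p × (∀ {y} → y ∈ p → y ≡ x))
∣p∣≡1⇒∃! p ∣p∣≡1 with nonempty? p
... | no empty = contradiction (trans (sym ∣p∣≡1) (∣Empty∣≡0 empty)) λ ()
... | yes (x , x∈p) = x , x∈p , λ {y} y∈p → decidable-stable (y ≟ x) λ y≢x →
  contradiction (trans (sym (x∈p⇒∣p∣≡1+∣p-x∣ (x∈p∧x≢y⇒x∈p-y y∈p y≢x)))
                  (ℕ.suc-injective (trans (sym (x∈p⇒∣p∣≡1+∣p-x∣ x∈p)) ∣p∣≡1))) λ ()

range : Vector (Fin n) k → Subset n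
range {k = zero}  g = ⊥
range {k = suc k} g = ⁅ g zero ⁆ ∪ range (g ∘ suc)

∈-range : (g : Vector (Fin n) k) (i : Fin k) → g i ∈ range g
∈-range g zero    = p⊆p∪q _ (x∈⁅x⁆ (g zero))
∈-range g (suc i) = q⊆p∪q ⁅ g zero ⁆ _ (∈-range (g ∘ suc) i)

∣range∣≤k : (g : Vector (Fin n) k) → ∣ range g ∣ ℕ.≤ k
∣range∣≤k {n} {zero}  g = ℕ.≤-reflexive (∣⊥∣≡0 n)
∣range∣≤k {n} {suc k} g = ℕ.≤-trans (∣p∪q∣≤∣p∣+∣q∣ ⁅ g zero ⁆ (range (g ∘ suc)))
  (ℕ.+-mono-≤ (ℕ.≤-reflexive (∣⁅x⁆∣≡1 (g zero))) (∣range∣≤k (g ∘ suc)))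

-- Parity of sets closed under a fixed-point-free involution.

Closed : (Fin n → Fin n) → Subset n → Set
Closed g p = ∀ {v} → v ∈ p → g v ∈ p

module _ (g : Fin n → Fin n) (involutive : ∀ v → g (g v) ≡ v) (g≢id : ∀ v → g v ≢ v) where

  -- An element `x` and its image `g x` are distinct and can be removed together. What remains is
  -- still closed because `g` is injective, so strict inclusion serves as the induction order.
  closed⇒even : (p : Subset n) → Closed g p → 2 ∣ ∣ p ∣
  closed⇒even p = go p (⊂-wellFounded p)
    where
    go : ∀ p → Acc _⊂_ p → Closed g p → 2 ∣ ∣ p ∣
    go p (acc rec) closed with nonempty? p
    ... | no empty = subst (2 ∣_) (sym (∣Empty∣≡0 empty)) (2 ∣0)
    ... | yes (x , x∈p) = subst (2 ∣_) (sym ∣p∣≡2+) (∣m∣n⇒∣m+n ∣-refl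
        (go p′ (rec (⊂-trans (x∈p⇒p-x⊂p gx∈p-x) (x∈p⇒p-x⊂p x∈p))) closed′))
      where
      p′ = p - x - g x
      gx∈p-x : g x ∈ p - x
      gx∈p-x = x∈p∧x≢y⇒x∈p-y (closed x∈p) (g≢id x)
      ∣p∣≡2+ : ∣ p ∣ ≡ 2 + ∣ p′ ∣
      ∣p∣≡2+ = trans (x∈p⇒∣p∣≡1+∣p-x∣ x∈p) (cong suc (x∈p⇒∣p∣≡1+∣p-x∣ gx∈p-x))
      closed′ : Closed g p′
      closed′ {v} v∈p′ = x∈p∧x≢y⇒x∈p-y (x∈p∧x≢y⇒x∈p-y (closed v∈p) gv≢x) gv≢gx
        where
        v∈p-x = p─q⊆p (p - x) ⁅ g x ⁆ v∈p′
        v∈p = p─q⊆p p ⁅ x ⁆ v∈p-x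
        gv≢x : g v ≢ x
        gv≢x gv≡x = x∈p-y⇒x≢y v∈p′ (trans (sym (involutive v)) (cong g gv≡x))
        gv≢gx : g v ≢ g x
        gv≢gx gv≡gx = x∈p-y⇒x≢y v∈p-x
          (trans (sym (involutive v)) (trans (cong g gv≡gx) (involutive x)))

-- 1-factors as fixed-point-free involutions.

∈-neighbourhood⁺ : (G : Graph n) {v u : Fin n} → Adj G v u → u ∈ neighbourhood G v
∈-neighbourhood⁺ G {v} {u} vu = lookup⇒[]= u (neighbourhood G v)
  (trans (lookup∘tabulate _ u) (dec-true (adj? G v u) vu))

∈-neighbourhood⁻ : (G : Graph n) {v u : Fin n} → u ∈ neighbourhood G v → Adj G v u
∈-neighbourhood⁻ G {v} {u} u∈N
  with adj? G v u | trans (sym (lookup∘tabulate (λ w → does (adj? G v w)) u)) ([]=⇒lookup u∈N)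
... | yes vu | _ = vu

module Factor (G : Graph n) (oneFactor : IsOneFactor G) where

  private
    partner! : ∀ v → ∃[ u ] (u ∈ neighbourhood G v × (∀ {w} → w ∈ neighbourhood G v → w ≡ u))
    partner! v = ∣p∣≡1⇒∃! (neighbourhood G v) (oneFactor v)

  partner : Fin n → Fin n
  partner v = proj₁ (partner! v)

  adj-partner : ∀ v → Adj G v (partner v)
  adj-partner v = ∈-neighbourhood⁻ G (proj₁ (proj₂ (partner! v)))

  adj⇒≡partner : ∀ {v u} → Adj G v u → u ≡ partner v
  adj⇒≡partner {v} vu = proj₂ (proj₂ (partner! v)) (∈-neighbourhood⁺ G vu)

  partner-involutive : ∀ v → partner (partner v) ≡ v
  partner-involutive v = sym (adj⇒≡partner (Graph.sym G (adj-partner v)))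

  partner≢id : ∀ v → partner v ≢ v
  partner≢id v eq = Graph.irrefl G v (subst (Adj G v) eq (adj-partner v))

-- Greedy construction of an independent set in the union of the factors.

module Greedy (f : Fin k → Fin n → Fin n)
  (involutive : ∀ i v → f i (f i v) ≡ v) (f≢id : ∀ i v → f i v ≢ v) where

  -- D contains every vertex of I and every neighbour of such a vertex, so
  -- that any vertex outside D may be added to I.
  record Partial (I D : Subset n) : Set where
    field
      I⊆D         : I ⊆ D
      dominated   : ∀ i {v} → v ∈ I → f i v ∈ D
      independent : ∀ i {v} → v ∈ I → f i v ∉ I

  open Partial

  none : Partial ⊥ ⊥
  none .I⊆D v∈⊥         = v∈⊥
  none .dominated _ v∈⊥ = contradiction v∈⊥ ∉⊥
  none .independent _ _ = ∉⊥

  -- A conflict between `u` and an old vertex of `I` would put `u` into `D`, directly or through the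
  -- involution. The set `E` need not contain neighbours of `u` already in `D`; this freedom is what
  -- saves a vertex when k is even.
  extend : ∀ {I D} → Partial I D → ∀ {u} → u ∉ D → (E : Subset n) → u ∈ E →
    (∀ i → f i u ∈ D ∪ E) → Partial (I ∪ ⁅ u ⁆) (D ∪ E)
  extend {I} {D} P {u} u∉D E u∈E fu∈D∪E = record
    { I⊆D = λ v∈I′ → case-I′ (p⊆p∪q E ∘ I⊆D P) (λ { refl → q⊆p∪q D E u∈E }) v∈I′
    ; dominated = λ i → case-I′ (p⊆p∪q E ∘ dominated P i) (λ { refl → fu∈D∪E i })
    ; independent = λ i {v} → case-I′
        (λ v∈I → case-I′ (independent P i v∈I)
                   (λ { refl → u∉D (dominated P i v∈I) }))
        (λ { refl → case-I′
                   (λ fu∈I → u∉D (subst (_∈ D) (involutive i u) (dominated P i fu∈I)))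
                   (f≢id i u) })
    }
    where
    case-I′ : ∀ {X : Set} {v} → (v ∈ I → X) → (v ≡ u → X) → v ∈ I ∪ ⁅ u ⁆ → X
    case-I′ l r v∈I′ = [ l , r ∘ x∈⁅y⁆⇒x≡y u ]′ (x∈p∪q⁻ I ⁅ u ⁆ v∈I′)

  -- Each chosen vertex pays for `c` vertices of `D`, and `r` is slack granted once. The slack is 0
  -- in the general argument and 1 for even k.
  Bounded : (c r : ℕ) → Subset n → Subset n → Set
  Bounded c r I D = ∣ D ∣ ℕ.≤ r + c * ∣ I ∣

  Extension : (c r : ℕ) → Subset n → Set
  Extension c r D = ∃[ I′ ] ∃[ D′ ] (Partial I′ D′ × Bounded c r I′ D′ × D ⊂ D′)

  extension : ∀ c r {I D} → Partial I D → ∀ {u} → u ∉ D → (E : Subset n) → u ∈ E →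
    (∀ i → f i u ∈ D ∪ E) → ∣ D ∣ + ∣ E ∣ ℕ.≤ r + c * suc ∣ I ∣ → Extension c r D
  extension c r {I} {D} P {u} u∉D E u∈E fu∈D∪E bound =
    I ∪ ⁅ u ⁆ , D ∪ E , extend P u∉D E u∈E fu∈D∪E , bounded , ⊂-∪ u∉D u∈E
    where
    open ℕ.≤-Reasoning
    bounded : Bounded c r (I ∪ ⁅ u ⁆) (D ∪ E)
    bounded = begin
      ∣ D ∪ E ∣              ≤⟨ ∣p∪q∣≤∣p∣+∣q∣ D E ⟩
      ∣ D ∣ + ∣ E ∣          ≤⟨ bound ⟩
      -- The new vertex really enlarges `I`: it lies outside `D`, hence outside `I`.
      r + c * suc ∣ I ∣      ≤⟨ ℕ.+-monoʳ-≤ r (ℕ.*-monoʳ-≤ c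
                                  (p⊂q⇒∣p∣<∣q∣ (⊂-∪ (u∉D ∘ I⊆D P) (x∈⁅x⁆ u)))) ⟩
      r + c * ∣ I ∪ ⁅ u ⁆ ∣  ∎

  -- Each step strictly enlarges `D`, so the iteration from the empty sets terminates, and it can
  -- stop only when no vertex is left outside `D`.
  exhaust : ∀ c r →
    (∀ {I D} → Partial I D → Bounded c r I D → ∀ {u} → u ∉ D → Extension c r D) →
    ∃[ I ] (Partial I ⊤ × Bounded c r I ⊤)
  exhaust c r step =
    go none (subst (ℕ._≤ r + c * ∣ ⊥ {n} ∣) (sym (∣⊥∣≡0 n)) z≤n) (⊃-wellFounded ⊥)
    where
    go : ∀ {I D} → Partial I D → Bounded c r I D → Acc _⊃_ D →
      ∃[ I ] (Partial I ⊤ × Bounded c r I ⊤)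
    go {I} {D} P b (acc rec) with any? (λ u → ¬? (u ∈? D))
    ... | yes (u , u∉D) = let I′ , D′ , P′ , b′ , D⊂D′ = step P b u∉D in go P′ b′ (rec D⊂D′)
    ... | no  ∄u∉D = I , subst (Partial I) D≡⊤ P , subst (Bounded c r I) D≡⊤ b
      where
      D≡⊤ : D ≡ ⊤
      D≡⊤ = ⊆-antisym (λ _ → ∈⊤) λ {u} _ → decidable-stable (u ∈? D) λ u∉D → ∄u∉D (u , u∉D)

  closedNeighbourhood : Fin n → Vector (Fin n) (suc k)
  closedNeighbourhood u = u ◂ λ i → f i u

  extension-closedNeighbourhood : ∀ c r {I D} → Partial I D → ∀ {u} → u ∉ D →
    ∣ D ∣ + suc k ℕ.≤ r + c * suc ∣ I ∣ → Extension c r D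
  extension-closedNeighbourhood c r {D = D} P {u} u∉D bound =
    extension c r P u∉D (range N[u]) (∈-range N[u] zero)
      (λ i → q⊆p∪q D (range N[u]) (∈-range N[u] (suc i)))
      (ℕ.≤-trans (ℕ.+-monoʳ-≤ ∣ D ∣ (∣range∣≤k N[u])) bound)
    where N[u] = closedNeighbourhood u

  Independent : Subset n → Set
  Independent I = ∀ i {v} → v ∈ I → f i v ∉ I

  -- A chosen vertex and its neighbours number at most k + 1, so every step is paid for without
  -- slack.
  largeIndependent : ∃[ I ] (Independent I × n ℕ.≤ suc k * ∣ I ∣)
  largeIndependent =
    let I , P , b = exhaust (suc k) 0 step
    in I , independent P , subst (ℕ._≤ suc k * ∣ I ∣) (∣⊤∣≡n n) b
    where
    step : ∀ {I D} → Partial I D → Bounded (suc k) 0 I D → ∀ {u} → u ∉ D → Extension (suc k) 0 D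
    step {I} {D} P b u∉D = extension-closedNeighbourhood (suc k) 0 P u∉D
      (subst (∣ D ∣ + suc k ℕ.≤_) (trans (ℕ.+-comm _ (suc k)) (sym (ℕ.*-suc (suc k) ∣ I ∣)))
        (ℕ.+-monoˡ-≤ (suc k) b))

-- When no edge leaves D, the 1-factor f zero matches D within itself, so ∣ D ∣
-- is even; since k is even this removes the slack of 1, which pays for a vertex
-- all of whose k neighbours lie outside D.  Otherwise there is a vertex outside
-- D with a neighbour in D, and adding it adds at most k vertices to D.
module GreedyEven (f : Fin (suc k) → Fin n → Fin n)
  (involutive : ∀ i v → f i (f i v) ≡ v) (f≢id : ∀ i v → f i v ≢ v)
  (2∣k : 2 ∣ suc k) where

  open Greedy f involutive f≢id

  even-bound : ∀ I {D} → Bounded (suc k) 1 I D → Closed (f zero) D → ∣ D ∣ ℕ.≤ suc k * ∣ I ∣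
  even-bound I {D} b closed with ℕ.m≤n⇒m<n∨m≡n b
  ... | inj₁ (s≤s ∣D∣≤) = ∣D∣≤
  -- If the slack were used up, the even number `∣ D ∣` would be 1 more than a multiple of the even
  -- number `suc k`, forcing 2 to divide 1.
  ... | inj₂ ∣D∣≡ with () ← ∣1⇒≡1 (∣m+n∣m⇒∣n (subst (2 ∣_) (trans ∣D∣≡ (ℕ.+-comm 1 (suc k * ∣ I ∣)))
      (closed⇒even (f zero) (involutive zero) (f≢id zero) D closed)) (∣m⇒∣m*n ∣ I ∣ 2∣k))

  extension-neighbour : ∀ {I D} → Partial I D → Bounded (suc k) 1 I D →
    ∀ i {v} → v ∈ D → f i v ∉ D → Extension (suc k) 1 D
  extension-neighbour {I} {D} P b i {v} v∈D u∉D =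
    extension (suc k) 1 P u∉D (range others) (∈-range others zero) covered (begin
      ∣ D ∣ + ∣ range others ∣      ≤⟨ ℕ.+-mono-≤ b (∣range∣≤k others) ⟩
      1 + suc k * ∣ I ∣ + suc k     ≡⟨ cong suc (ℕ.+-comm _ (suc k)) ⟩
      1 + (suc k + suc k * ∣ I ∣)   ≡⟨ cong suc (sym (ℕ.*-suc (suc k) ∣ I ∣)) ⟩
      1 + suc k * suc ∣ I ∣         ∎)
    where
    open ℕ.≤-Reasoning
    u = f i v
    others : Vector (Fin n) (suc k)
    -- `punchIn i` skips the factor `i`, in which the neighbour of `u` is `v` and already lies in
    -- `D`. This leaves `u` and `k` neighbours, `suc k` vertices in all.
    others = u ◂ λ j → f (punchIn i j) u
    covered : ∀ j → f j u ∈ D ∪ range others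
    covered j with i ≟ j
    ... | yes refl = p⊆p∪q (range others) (subst (_∈ D) (sym (involutive i v)) v∈D)
    ... | no  i≢j  = q⊆p∪q D (range others) (subst (λ j → f j u ∈ range others)
                       (punchIn-punchOut i≢j) (∈-range others (suc (punchOut i≢j))))

  step : ∀ {I D} → Partial I D → Bounded (suc k) 1 I D → ∀ {u} → u ∉ D → Extension (suc k) 1 D
  step {I} {D} P b u∉D with any? (λ i → any? (λ v → (v ∈? D) ×-dec ¬? (f i v ∈? D)))
  ... | yes (i , v , v∈D , fv∉D) = extension-neighbour P b i v∈D fv∉D
  ... | no  ∄edge = extension-closedNeighbourhood (suc k) 1 P u∉D (begin
      ∣ D ∣ + suc (suc k)              ≤⟨ ℕ.+-monoˡ-≤ (2 + k) (even-bound I b closed) ⟩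
      suc k * ∣ I ∣ + (2 + k)          ≡⟨ ℕ.+-comm _ (2 + k) ⟩
      1 + (suc k + suc k * ∣ I ∣)      ≡⟨ cong suc (sym (ℕ.*-suc (suc k) ∣ I ∣)) ⟩
      1 + suc k * suc ∣ I ∣            ∎)
    where
    open ℕ.≤-Reasoning
    closed : Closed (f zero) D
    closed {v} v∈D = decidable-stable (f zero v ∈? D) λ fv∉D → ∄edge (zero , v , v∈D , fv∉D)

  largeIndependent-even : ∃[ I ] (Independent I × n ℕ.≤ suc k * ∣ I ∣)
  largeIndependent-even =
    let I , P , b = exhaust (suc k) 1 step
    -- The full set is trivially closed, so parity also removes the slack from the final count.
    in I , Partial.independent P , subst (ℕ._≤ suc k * ∣ I ∣) (∣⊤∣≡n n) (even-bound I b (λ _ → ∈⊤))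

-- From independent sets to upper bounds on `γsd`.

module Bounds (F : Vector (Graph n) (suc k)) (oneFactor : ∀ i → IsOneFactor (F i)) where

  private module Factorᵢ i = Factor (F i) (oneFactor i)

  open Factorᵢ
  open Greedy partner partner-involutive partner≢id using (Independent; largeIndependent)
  open GreedyEven partner partner-involutive partner≢id using (largeIndependent-even)

  -- In each factor the partner of a vertex of `I` lies outside `I`, so the complement of `I`
  -- dominates.
  γsd≤n∸∣I∣ : ∀ I → Independent I → γsd F ℕ.≤ n ∸ ∣ I ∣
  γsd≤n∸∣I∣ I independent = subst (γsd F ℕ.≤_) (∣∁p∣≡n∸∣p∣ I) (γsd-minimal F (∁ I) dominating)
    where
    dominating : IsSimultaneousDominating F (∁ I)
    dominating i v v∉∁I =
      partner i v , x∉p⇒x∈∁p (independent i (x∉∁p⇒x∈p v∉∁I)) , adj-partner i v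

  [1+c]*γsd≤c*n : ∀ c → ∃[ I ] (Independent I × n ℕ.≤ suc c * ∣ I ∣) → suc c * γsd F ℕ.≤ c * n
  [1+c]*γsd≤c*n c (I , independent , n≤) = begin
    suc c * γsd F               ≤⟨ ℕ.*-monoʳ-≤ (suc c) (γsd≤n∸∣I∣ I independent) ⟩
    suc c * (n ∸ ∣ I ∣)         ≡⟨ ℕ.*-distribˡ-∸ (suc c) n ∣ I ∣ ⟩
    suc c * n ∸ suc c * ∣ I ∣   ≤⟨ ℕ.∸-monoʳ-≤ (suc c * n) n≤ ⟩
    suc c * n ∸ n               ≡⟨ ℕ.m+n∸m≡n n (c * n) ⟩
    c * n                       ∎
    where open ℕ.≤-Reasoning

  [1+k]*γsd≤k*n : suc (suc k) * γsd F ℕ.≤ suc k * n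
  [1+k]*γsd≤k*n = [1+c]*γsd≤c*n (suc k) largeIndependent

  even⇒k*γsd≤[k-1]*n : 2 ∣ suc k → suc k * γsd F ℕ.≤ k * n
  even⇒k*γsd≤[k-1]*n 2∣k = [1+c]*γsd≤c*n k (largeIndependent-even 2∣k)

-- 1-factorization of the complete graph on an even number of vertices.

module FromInvolution (p : Fin n → Fin n) (involutive : ∀ v → p (p v) ≡ v) (p≢id : ∀ v → p v ≢ v) where

  graph : Graph n
  graph = record
    { Adj    = λ v u → p v ≡ u
    ; adj?   = λ v u → p v ≟ u
    ; sym    = λ { {v} refl → involutive v }
    ; irrefl = p≢id
    }

  isOneFactor : IsOneFactor graph
  isOneFactor v = trans (cong ∣_∣ (⊆-antisym
    (λ u∈N → subst (_∈ ⁅ p v ⁆) (∈-neighbourhood⁻ graph u∈N) (x∈⁅x⁆ (p v)))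
    (λ u∈⁅pv⁆ → ∈-neighbourhood⁺ graph {v} (sym (x∈⁅y⁆⇒x≡y (p v) u∈⁅pv⁆)))))
    (∣⁅x⁆∣≡1 (p v))

module Congruence (N : ℕ) .{{_ : NonZero N}} where

  infix 4 _≈_
  _≈_ : ℕ → ℕ → Set
  a ≈ b = a % N ≡ b % N

  +-congʳ : ∀ a b c → a ≈ b → a + c ≈ b + c
  +-congʳ a b c a≈b = begin
    (a + c) % N          ≡⟨ %-distribˡ-+ a c N ⟩
    (a % N + c % N) % N  ≡⟨ cong (λ r → (r + c % N) % N) a≈b ⟩
    (b % N + c % N) % N  ≡⟨ %-distribˡ-+ b c N ⟨
    (b + c) % N          ∎
    where open ≡-Reasoning

  *-congʳ : ∀ a b c → a ≈ b → a * c ≈ b * c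
  *-congʳ a b c a≈b = begin
    (a * c) % N            ≡⟨ %-distribˡ-* a c N ⟩
    (a % N * (c % N)) % N  ≡⟨ cong (λ r → (r * (c % N)) % N) a≈b ⟩
    (b % N * (c % N)) % N  ≡⟨ %-distribˡ-* b c N ⟨
    (b * c) % N            ∎
    where open ≡-Reasoning

  toℕ-mod : ∀ a → toℕ (a mod N) ≈ a
  toℕ-mod a = trans (cong (_% N) (toℕ-fromℕ< (m%n<n a N))) (m%n%n≡m%n a N)

  toℕ-injective-≈ : (x y : Fin N) → toℕ x ≈ toℕ y → x ≡ y
  toℕ-injective-≈ x y x≈y = toℕ-injective (begin
    toℕ x      ≡⟨ m<n⇒m%n≡m (toℕ<n x) ⟨
    toℕ x % N  ≡⟨ x≈y ⟩
    toℕ y % N  ≡⟨ m<n⇒m%n≡m (toℕ<n y) ⟩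
    toℕ y      ∎)
    where open ≡-Reasoning

-- The classical 1-factorization of the complete graph on ℤ/N ∪ {∞}, N = 2h + 1
-- odd, with ∞ = zero and the residue x encoded as suc x: the factor of c
-- contains the edges xy with x + y ≡ c, and matches ∞ with c / 2.
module Cyclic (h : ℕ) where

  private
    N : ℕ
    N = suc (h * 2)

  open Congruence N

  -- This is c - x modulo `N`, written without subtraction: `h * 2` is N - 1, which represents -1.
  reflect : ℕ → Fin N → Fin N
  reflect c x = (c + toℕ x * (h * 2)) mod N

  -- `suc h` is the inverse of 2 modulo `N`, since 2(h + 1) = N + 1.
  half : ℕ → Fin N
  half c = (c * suc h) mod N

  reflect-sum : ∀ c x → toℕ (reflect c x) + toℕ x ≈ c
  reflect-sum c x = begin
    (toℕ (reflect c x) + toℕ x) % N            ≡⟨ +-congʳ (toℕ (reflect c x)) (c + toℕ x * (h * 2)) (toℕ x)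
                                                     (toℕ-mod (c + toℕ x * (h * 2))) ⟩
    (c + toℕ x * (h * 2) + toℕ x) % N          ≡⟨ cong (_% N) (lemma c (toℕ x) (h * 2)) ⟩
    (c + toℕ x * N) % N                        ≡⟨ [m+kn]%n≡m%n c (toℕ x) N ⟩
    c % N                                      ∎
    where
    open ≡-Reasoning
    lemma : ∀ c x m → c + x * m + x ≡ c + x * suc m
    lemma = solve-∀

  -- Adding `toℕ z * (h * 2)`, which represents -z, to both sides cancels `z`.
  +-cancelʳ : (z x y : Fin N) → toℕ x + toℕ z ≈ toℕ y + toℕ z → x ≡ y
  +-cancelʳ z x y eq = toℕ-injective-≈ x y (trans (sym (shift x))
    (trans (+-congʳ (toℕ x + toℕ z) (toℕ y + toℕ z) (toℕ z * (h * 2)) eq) (shift y)))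
    where
    lemma : ∀ x z m → x + z + z * m ≡ x + z * suc m
    lemma = solve-∀
    shift : ∀ x → toℕ x + toℕ z + toℕ z * (h * 2) ≈ toℕ x
    shift x = trans (cong (_% N) (lemma (toℕ x) (toℕ z) (h * 2))) ([m+kn]%n≡m%n (toℕ x) (toℕ z) N)

  reflect-unique : ∀ c x y → toℕ y + toℕ x ≈ c → reflect c x ≡ y
  reflect-unique c x y eq = +-cancelʳ x (reflect c x) y (trans (reflect-sum c x) (sym eq))

  reflect-involutive : ∀ c x → reflect c (reflect c x) ≡ x
  reflect-involutive c x = reflect-unique c (reflect c x) x
    (trans (cong (_% N) (ℕ.+-comm (toℕ x) _)) (reflect-sum c x))

  double-half : ∀ a → a * suc h + a * suc h ≈ a
  double-half a = trans (cong (_% N) (lemma a h)) ([m+kn]%n≡m%n a a N)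
    where
    lemma : ∀ a h → a * suc h + a * suc h ≡ a + a * suc (h * 2)
    lemma = solve-∀

  half-fixed : ∀ c → reflect c (half c) ≡ half c
  half-fixed c = reflect-unique c (half c) (half c) (begin
    (toℕ (half c) + toℕ (half c)) % N   ≡⟨ +-congʳ (toℕ (half c)) (c * suc h) (toℕ (half c))
                                             (toℕ-mod (c * suc h)) ⟩
    (c * suc h + toℕ (half c)) % N      ≡⟨ cong (_% N) (ℕ.+-comm (c * suc h) _) ⟩
    (toℕ (half c) + c * suc h) % N      ≡⟨ +-congʳ (toℕ (half c)) (c * suc h) (c * suc h)
                                             (toℕ-mod (c * suc h)) ⟩
    (c * suc h + c * suc h) % N         ≡⟨ double-half c ⟩
    c % N                               ∎)
    where open ≡-Reasoning

  -- A fixed point satisfies 2x ≡ c; multiplying by `suc h` inverts the 2.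
  fixed⇒half : ∀ c x → reflect c x ≡ x → x ≡ half c
  fixed⇒half c x eq = toℕ-injective-≈ x (half c) (begin
    toℕ x % N                             ≡⟨ double-half (toℕ x) ⟨
    (toℕ x * suc h + toℕ x * suc h) % N   ≡⟨ cong (_% N) (ℕ.*-distribʳ-+ (suc h) (toℕ x) (toℕ x)) ⟨
    ((toℕ x + toℕ x) * suc h) % N         ≡⟨ *-congʳ (toℕ x + toℕ x) c (suc h) double≈c ⟩
    (c * suc h) % N                       ≡⟨ toℕ-mod (c * suc h) ⟨
    toℕ (half c) % N                      ∎)
    where
    open ≡-Reasoning
    double≈c : toℕ x + toℕ x ≈ c
    double≈c = trans (cong (λ y → (toℕ y + toℕ x) % N) (sym eq)) (reflect-sum c x)

  mate : ℕ → Fin (suc N) → Fin (suc N)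
  mate c zero    = suc (half c)
  mate c (suc x) with x ≟ half c
  ... | yes _ = zero
  ... | no  _ = suc (reflect c x)

  mate-half : ∀ c → mate c (suc (half c)) ≡ zero
  mate-half c with half c ≟ half c
  ... | yes _ = refl
  ... | no ≢  = contradiction refl ≢

  mate-≢half : ∀ c {x} → x ≢ half c → mate c (suc x) ≡ suc (reflect c x)
  mate-≢half c {x} x≢ with x ≟ half c
  ... | yes x≡ = contradiction x≡ x≢
  ... | no  _  = refl

  mate-involutive : ∀ c v → mate c (mate c v) ≡ v
  mate-involutive c zero = mate-half c
  mate-involutive c (suc x) with x ≟ half c
  ... | yes refl = refl
  -- The reflection of `x` is not `half c` either: reflecting back would give `x` equal to `half c`.
  ... | no  x≢   = trans (mate-≢half c λ eq → x≢
          (trans (sym (reflect-involutive c x)) (trans (cong (reflect c) eq) (half-fixed c))))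
          (cong suc (reflect-involutive c x))

  mate≢id : ∀ c v → mate c v ≢ v
  mate≢id c (suc x) with x ≟ half c
  ... | yes _  = λ ()
  ... | no  x≢ = λ eq → x≢ (fixed⇒half c x (suc-injective eq))

  joining : (x y : Fin N) → ∃[ c ] (c < N × reflect c x ≡ y)
  joining x y = s % N , m%n<n s N , reflect-unique (s % N) x y (sym (m%n%n≡m%n s N))
    where
    s = toℕ y + toℕ x

  mate-covers : ∀ u v → u ≢ v → ∃[ c ] (c < N × mate c u ≡ v)
  mate-covers zero    zero    u≢v = contradiction refl u≢v
  mate-covers zero    (suc y) _   =
    -- The edge from ∞ to `y` belongs to the factor of 2y, whose reflection fixes `y`.
    let c , c<N , eq = joining y y in c , c<N , cong suc (sym (fixed⇒half c y eq))
  mate-covers (suc x) zero    _   =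
    let c , c<N , eq = joining x x
    in c , c<N , trans (cong (λ y → mate c (suc y)) (fixed⇒half c x eq)) (mate-half c)
  mate-covers (suc x) (suc y) u≢v =
    let c , c<N , eq = joining x y
    -- If `x` were `half c`, the reflection taking `x` to `y` would fix `x`, contradicting that the
    -- endpoints differ.
    in c , c<N , trans (mate-≢half c λ x≡half → u≢v (cong suc
         (trans x≡half (trans (sym (half-fixed c)) (trans (cong (reflect c) (sym x≡half)) eq)))))
         (cong suc eq)

  factor : ℕ → Graph (suc N)
  factor c = FromInvolution.graph (mate c) (mate-involutive c) (mate≢id c)

  factor-isOneFactor : ∀ c → IsOneFactor (factor c)
  factor-isOneFactor c = FromInvolution.isOneFactor (mate c) (mate-involutive c) (mate≢id c)

  -- Only `c` modulo `N` affects the edges of `factor c`, so an index of `N` or more repeats an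
  -- earlier factor. The even case, where k = N + 1, relies on this.
  factors : Vector (Graph (suc N)) k
  factors i = factor (toℕ i)

  -- The first `N` factors cover every edge of the complete graph. Two distinct vertices outside `S`
  -- would be matched in one of them, and neither would have a neighbour in `S` there; hence at most
  -- one of the N + 1 vertices is missing from `S`.
  N≤γsd : N ℕ.≤ k → N ℕ.≤ γsd (factors {k})
  N≤γsd {k} N≤k with S , dominating , ∣S∣≡γsd ← γsd-attained (factors {k}) =
    subst (N ℕ.≤_) ∣S∣≡γsd (ℕ.≤-trans (ℕ.∸-monoʳ-≤ (suc N) ∣∁S∣≤1) (ℕ.≤-reflexive
      (trans (cong (suc N ∸_) (∣∁p∣≡n∸∣p∣ S)) (ℕ.m∸[m∸n]≡n (∣p∣≤n S)))))
    where
    unique : ∀ {u v} → u ∈ ∁ S → v ∈ ∁ S → u ≡ v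
    unique {u} {v} u∈∁S v∈∁S = decidable-stable (u ≟ v) λ u≢v →
      let c , c<N , mate≡v = mate-covers u v u≢v
          i = fromℕ< (ℕ.<-≤-trans c<N N≤k)
          w , w∈S , mate≡w = dominating i u (x∈∁p⇒x∉p u∈∁S)
          v≡w = trans (sym mate≡v) (trans (cong (λ c → mate c u) (sym (toℕ-fromℕ< _))) mate≡w)
      in x∈∁p⇒x∉p v∈∁S (subst (_∈ S) (sym v≡w) w∈S)
    ∣∁S∣≤1 : ∣ ∁ S ∣ ℕ.≤ 1
    ∣∁S∣≤1 = ∣p∣≤1 (∁ S) unique

-- Opened only here: with the prefix + in scope, ∣ p ∣ + ∣ q ∣ does not parse
-- unambiguously.
open import Data.Integer.Base using (+_)

-- Reduction of the rational bounds to inequalities between natural numbers.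

module _ (m j n : ℕ) where
  open ℚᵘ.≤-Reasoning

  fraction : ℚ
  fraction = (+ m / suc j) ℚ.* (+ n / 1)

  -- Unnormalised fractions avoid reduction to lowest terms, so comparison becomes plain
  -- cross-multiplication. The second argument of `mkℚᵘ` is the denominator minus 1.
  fractionᵘ : ℚ.toℚᵘ fraction ℚᵘ.≃ ℚᵘ.mkℚᵘ (+ (m * n)) j
  fractionᵘ = begin-equality
    ℚ.toℚᵘ fraction                                       ≃⟨ ℚ.toℚᵘ-homo-* (+ m / suc j) (+ n / 1) ⟩
    ℚ.toℚᵘ (+ m / suc j) ℚᵘ.* ℚ.toℚᵘ (+ n / 1)            ≃⟨ ℚᵘ.*-cong
      (ℚ.toℚᵘ-fromℚᵘ (ℚᵘ.mkℚᵘ (+ m) j)) (ℚ.toℚᵘ-fromℚᵘ (ℚᵘ.mkℚᵘ (+ n) 0)) ⟩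
    ℚᵘ.mkℚᵘ (+ m) j ℚᵘ.* ℚᵘ.mkℚᵘ (+ n) 0                  ≡⟨ cong₂ ℚᵘ.mkℚᵘ (sym (ℤ.pos-* m n)) (ℕ.*-identityʳ j) ⟩
    ℚᵘ.mkℚᵘ (+ (m * n)) j                                 ∎

  ≤-fraction : ∀ g → suc j * g ℕ.≤ m * n → + g / 1 ≤ fraction
  ≤-fraction g le = ℚ.toℚᵘ-cancel-≤ (begin
    ℚ.toℚᵘ (+ g / 1)         ≃⟨ ℚ.toℚᵘ-fromℚᵘ (ℚᵘ.mkℚᵘ (+ g) 0) ⟩
    ℚᵘ.mkℚᵘ (+ g) 0          ≤⟨ ℚᵘ.*≤* (subst₂ ℤ._≤_ (ℤ.pos-* g (suc j)) (ℤ.pos-* (m * n) 1)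
                                  (ℤ.+≤+ (subst₂ ℕ._≤_ (ℕ.*-comm (suc j) g) (sym (ℕ.*-identityʳ (m * n))) le))) ⟩
    ℚᵘ.mkℚᵘ (+ (m * n)) j    ≃⟨ fractionᵘ ⟨
    ℚ.toℚᵘ fraction          ∎)

  fraction-≤ : ∀ g → m * n ℕ.≤ suc j * g → fraction ≤ + g / 1
  fraction-≤ g le = ℚ.toℚᵘ-cancel-≤ (begin
    ℚ.toℚᵘ fraction          ≃⟨ fractionᵘ ⟩
    ℚᵘ.mkℚᵘ (+ (m * n)) j    ≤⟨ ℚᵘ.*≤* (subst₂ ℤ._≤_ (ℤ.pos-* (m * n) 1) (ℤ.pos-* g (suc j))
                                  (ℤ.+≤+ (subst₂ ℕ._≤_ (sym (ℕ.*-identityʳ (m * n))) (ℕ.*-comm (suc j) g) le))) ⟩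
    ℚᵘ.mkℚᵘ (+ g) 0          ≃⟨ ℚ.toℚᵘ-fromℚᵘ (ℚᵘ.mkℚᵘ (+ g) 0) ⟨
    ℚ.toℚᵘ (+ g / 1)         ∎)

bound-even : ∀ k n .{{_ : NonTrivial (suc k)}} → 2 ∣ suc k → bound (suc k) n ≡ fraction k k n
bound-even k n 2∣k =
  cong (if_then fraction k k n else fraction (suc k) (suc k) n) (dec-true (2 ∣? suc k) 2∣k)

bound-odd : ∀ k n .{{_ : NonTrivial (suc k)}} → ¬ 2 ∣ suc k →
  bound (suc k) n ≡ fraction (suc k) (suc k) n
bound-odd k n 2∤k =
  cong (if_then fraction k k n else fraction (suc k) (suc k) n) (dec-false (2 ∣? suc k) 2∤k)

∤⇒odd : ∀ k → ¬ 2 ∣ k → ∃[ h ] k ≡ suc (h * 2)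
∤⇒odd k 2∤k with k % 2 in k%2≡r | m%n<n k 2 | m≡m%n+[m/n]*n k 2
... | 0           | _            | _  = contradiction (m%n≡0⇒n∣m k 2 k%2≡r) 2∤k
... | 1           | _            | k≡ = k ℕ./ 2 , k≡
... | suc (suc _) | s≤s (s≤s ()) | _

≤-bound : ∀ k n g .{{_ : NonTrivial (suc k)}} →
  (2 ∣ suc k → suc k * g ℕ.≤ k * n) → suc (suc k) * g ℕ.≤ suc k * n → + g / 1 ≤ bound (suc k) n
≤-bound k n g even arbitrary = split (2 ∣? suc k)
  where
  split : Dec (2 ∣ suc k) → + g / 1 ≤ bound (suc k) n
  split (yes 2∣k) = subst (+ g / 1 ≤_) (sym (bound-even k n 2∣k)) (≤-fraction k k n g (even 2∣k))
  split (no  2∤k) = subst (+ g / 1 ≤_) (sym (bound-odd k n 2∤k))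
    (≤-fraction (suc k) (suc k) n g arbitrary)

-- The upper bound and its sharpness.

γsd≤bound : ∀ k .{{_ : NonTrivial k}} (F : Vector (Graph n) k) → (∀ i → IsOneFactor (F i)) →
  + γsd F / 1 ≤ bound k n
γsd≤bound zero = contradiction (nonTrivial⇒n>1 0) λ ()
γsd≤bound {n} (suc k) F oneFactor =
  ≤-bound k n (γsd F) (even⇒k*γsd≤[k-1]*n) [1+k]*γsd≤k*n
  where open Bounds F oneFactor

Sharp : (k : ℕ) .{{_ : NonTrivial k}} → Set₁
Sharp k = ∃[ n ] (2 ∣ n × n ≥ 2 ×
  (Σ[ F ∈ Vector (Graph n) k ] ((∀ i → IsOneFactor (F i)) × + γsd F / 1 ≡ bound k n)))

-- The upper bound is already available, so equality needs only that the bound on N + 1 vertices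
-- does not exceed `N`, the lower bound on `γsd`.
cyclic-sharp : ∀ h k .{{_ : NonTrivial k}} → let N = suc (h * 2) in
  N ℕ.≤ k → (∀ g → N ℕ.≤ g → bound k (suc N) ≤ + g / 1) → Sharp k
cyclic-sharp h k N≤k bound≤ =
  suc (suc (h * 2)) , divides (suc h) refl , s≤s (s≤s z≤n) , factors , oneFactors ,
  ℚ.≤-antisym (γsd≤bound k factors oneFactors) (bound≤ (γsd factors) (N≤γsd N≤k))
  where
  open Cyclic h
  oneFactors : ∀ i → IsOneFactor (factors {k} i)
  oneFactors i = factor-isOneFactor (toℕ i)

sharp-even : ∀ k .{{_ : NonTrivial k}} → 2 ∣ k → Sharp k
sharp-even _ (divides zero refl) = contradiction (nonTrivial⇒n>1 0) λ ()
-- Here k = N + 1 is also the number of vertices, and the bound equals k - 1 = N.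
sharp-even k 2∣k@(divides (suc h) refl) = cyclic-sharp h k (ℕ.n≤1+n N) λ g N≤g →
  subst (_≤ + g / 1) (sym (bound-even N (suc N) 2∣k))
    (fraction-≤ N N (suc N) g (ℕ.≤-trans (ℕ.≤-reflexive (ℕ.*-comm N (suc N)))
      (ℕ.*-monoʳ-≤ (suc N) N≤g)))
  where
  N : ℕ
  N = suc (h * 2)

sharp-odd : ∀ k .{{_ : NonTrivial k}} → ¬ 2 ∣ k → ∃[ h ] k ≡ suc (h * 2) → Sharp k
-- Here k = N, there are k + 1 vertices, and the bound equals k.
sharp-odd k 2∤k (h , refl) = cyclic-sharp h k ℕ.≤-refl λ g k≤g →
  subst (_≤ + g / 1) (sym (bound-odd (h * 2) (suc k) 2∤k))
    (fraction-≤ k k (suc k) g (ℕ.≤-trans (ℕ.≤-reflexive (ℕ.*-comm k (suc k)))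
      (ℕ.*-monoʳ-≤ (suc k) k≤g)))

sharp : ∀ k .{{_ : NonTrivial k}} → Sharp k
sharp k = split (2 ∣? k)
  where
  split : Dec (2 ∣ k) → Sharp k
  split (yes 2∣k) = sharp-even k 2∣k
  split (no  2∤k) = sharp-odd k 2∤k (∤⇒odd k 2∤k)

theorem21 : ∀ (k : ℕ) .{{_ : NonTrivial k}} →
    (∀ (n : ℕ) → 2 ∣ n → (F : Vector (Graph n) k) → (∀ i → IsOneFactor (F i)) →
    + γsd F / 1 ≤ bound k n) ×
    (∃[ n ] (2 ∣ n × n ≥ 2 ×
    (Σ[ F ∈ Vector (Graph n) k ] ((∀ i → IsOneFactor (F i)) ×
    + γsd F / 1 ≡ bound k n))))
theorem21 k = (λ n _ F oneFactor → γsd≤bound k F oneFactor) , sharp k
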